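{- Let $n\ge 1$ and $R\ge 0$ be integers. Let $\phi(n,R)$ be the maximum total number of 0's in a minimal $(n,R)^+$-code, and let $\bar\phi(n,R)$ be the minimum total number of 1's in a minimal $(n,R)^+$-code. Assume that $R\le n$. Then: (1) $K^+(n,R)-K^+(n-1,R)\ge \phi(n,R)/n$; (2) $K^+(n-1,R)\le \bar\phi(n,R)/n$; (3) $K^+(n,R)<K^+(n+1,R)$; and (4) $K^+(n,R)>K^+(n,R+1)$.
   Context: $Q_n=\{0,1\}^n$ is ordered by $x\preceq y$ iff $x_i\le y_i$ for all $i$, and $d(x,y)$ is the Hamming distance. The downward directed ball is $B_n^-(x,R)=\{y\in Q_n: y\preceq x,\ d(x,y)\le R\}$. A set $\mathcal{C}\subseteq Q_n$ downward $R$-covers $Q_n$ if $Q_n=\bigcup_{c\in\mathcal{C}}B_n^-(c,R)$. $K^+(n,R)$ denotes the minimum size of a set $\mathcal{C}\subseteq Q_n$ that downward $R$-covers $Q_n$ (in particular $K^+(n,R)=1$ for $R\ge n$). A minimal $(n,R)^+$-code is a set $\mathcal{C}\subseteq Q_n$ of size $K^+(n,R)$ that downward $R$-covers $Q_n$. The total number of 0's (resp. 1's) in a code is the sum over its codewords of the number of coordinates equal to 0 (resp. 1).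
   Formalization: Part (4) is stated only for R < n rather than R ≤ n, because at R = n it is false: K⁺(n,n) = 1 = K⁺(n,n+1). Parts (1)–(3) are stated for all R ≤ n. -}

module Defs where

open import Data.Bool using (Bool; true; false; _≤_)
open import Data.Bool.Properties using (_≟_; _≤?_)
open import Data.Nat using (ℕ; zero; suc; _+_; _*_; z≤n; s≤s; s≤s⁻¹)
  renaming (_≤_ to _≤ⁿ_; _≟_ to _≟ⁿ_; _≤?_ to _≤ⁿ?_)
open import Data.Nat.Properties using (≤-refl; +-mono-≤; ≤∧≢⇒<; n≤0⇒n≡0)
open import Data.Product using (∃; _×_; _,_; proj₁; proj₂; uncurry)
open import Data.Sum using (inj₁; inj₂; [_,_]′)
open import Data.Vec using (Vec; []; _∷_; _++_; map; zip; count; sum)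
open import Data.Vec.Properties using (count≤n; ∷-injectiveʳ; ≡-dec)
open import Data.Vec.Membership.Propositional using () renaming (_∈_ to _∈ᵛ_)
open import Data.Vec.Membership.Propositional.Properties using (∈-++⁺ˡ; ∈-++⁺ʳ; ∈-map⁺)
open import Data.Vec.Relation.Binary.Pointwise.Inductive as Pointwise using (Pointwise)
open import Data.Vec.Relation.Unary.All as All using ([]; _∷_)
import Data.Vec.Relation.Unary.All.Properties as All
open import Data.Vec.Relation.Unary.AllPairs using (allPairs?; []; _∷_)
import Data.Vec.Relation.Unary.AllPairs.Properties as AllPairs
open import Data.Vec.Relation.Unary.Any as Any using (Any; here)
open import Data.Vec.Relation.Unary.Unique.Propositional using (Unique)
import Data.Vec.Relation.Unary.Unique.Propositional.Properties as Unique
open import Function using (_∘_)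
open import Level using (0ℓ)
open import Relation.Binary using (Rel)
open import Relation.Binary.PropositionalEquality using (_≡_; refl; sym; subst)
open import Relation.Nullary using (Dec; yes; no; ¬?; contradiction)
open import Relation.Nullary.Decidable using (map′; decidable-stable; _×-dec_; _⊎-dec_)
open import Relation.Unary using (Pred; Decidable; _∈_)

Q : ℕ → Set
Q n = Vec Bool n

infix 4 _⪯_

-- Bool's _≤_ has false ≤ true, so false is the digit 0 and true the digit 1.
_⪯_ : ∀ {n} → Rel (Q n) 0ℓ
_⪯_ = Pointwise _≤_

d : ∀ {n} → Q n → Q n → ℕ
d x y = count (¬? ∘ uncurry _≟_) (zip x y)

B⁻ : ∀ {n} → Q n → ℕ → Pred (Q n) 0ℓ
B⁻ x R y = y ⪯ x × d x y ≤ⁿ R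

-- A subset of Q n of size k is presented as a duplicate-free vector of
-- length k listing its elements.
DownwardCovers : ∀ {n k} → ℕ → Vec (Q n) k → Set
DownwardCovers {n} R C = (y : Q n) → Any (λ c → y ∈ B⁻ c R) C

IsCode : (n R : ℕ) → ∀ {k} → Vec (Q n) k → Set
IsCode n R C = Unique C × DownwardCovers R C

zeros ones : ∀ {n} → Q n → ℕ
zeros = count (_≟ false)
ones  = count (_≟ true)

totalZeros totalOnes : ∀ {n k} → Vec (Q n) k → ℕ
totalZeros C = sum (map zeros C)
totalOnes  C = sum (map ones C)

IsMinimum IsMaximum : Pred ℕ 0ℓ → Pred ℕ 0ℓ
IsMinimum P m = P m × (∀ k → P k → m ≤ⁿ k)
IsMaximum P m = P m × (∀ k → P k → k ≤ⁿ m)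

minimum : ∀ {P} → Decidable P → ∀ k → P k → ∃ (IsMinimum P)
minimum P? zero    p = zero , p , λ _ _ → z≤n
minimum P? (suc k) p with P? zero
... | yes p₀ = zero , p₀ , λ _ _ → z≤n
... | no ¬p₀ with minimum (P? ∘ suc) k p
...   | m , pm , least = suc m , pm , λ where
        zero    q → contradiction q ¬p₀
        (suc j) q → s≤s (least j q)

maximum : ∀ {P} → Decidable P → ∀ b → (∀ k → P k → k ≤ⁿ b) → ∃ P → ∃ (IsMaximum P)
maximum {P} P? zero bound (k , p) =
  zero , subst P (n≤0⇒n≡0 (bound k p)) p , bound
maximum P? (suc b) bound e with P? (suc b)
... | yes p = suc b , p , bound
... | no ¬p = maximum P? b
  (λ k q → s≤s⁻¹ (≤∧≢⇒< (bound k q) λ { refl → ¬p q })) e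

-- Existential and universal quantification over the finite types Q n and
-- Vec (Q n) k preserve decidability, so the extrema below can be computed.
Searchable : Set → Set₁
Searchable A = ∀ {P : Pred A 0ℓ} → Decidable P → Dec (∃ P)

search-Bool : Searchable Bool
search-Bool P? = map′
  [ (λ p → false , p) , (λ p → true , p) ]′
  (λ { (false , p) → inj₁ p ; (true , p) → inj₂ p })
  (P? false ⊎-dec P? true)

search-Vec : ∀ {A} → Searchable A → ∀ k → Searchable (Vec A k)
search-Vec s zero    P? = map′ ([] ,_) (λ { ([] , p) → p }) (P? [])
search-Vec s (suc k) P? = map′
  (λ { (x , xs , p) → x ∷ xs , p })
  (λ { (x ∷ xs , p) → x , xs , p })
  (s λ x → search-Vec s k λ xs → P? (x ∷ xs))

search-Q : ∀ n → Searchable (Q n)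
search-Q = search-Vec search-Bool

all-Q? : ∀ n {P : Pred (Q n) 0ℓ} → Decidable P → Dec (∀ y → P y)
all-Q? n P? with search-Q n (¬? ∘ P?)
... | yes (y , ¬p) = no λ f → ¬p (f y)
... | no ∄¬p = yes λ y → decidable-stable (P? y) λ ¬p → ∄¬p (y , ¬p)

isCode? : ∀ n R {k} → Decidable (IsCode n R {k})
isCode? n R C =
  allPairs? (λ x y → ¬? (≡-dec _≟_ x y)) C
  ×-dec
  all-Q? n (λ y → Any.any? (λ c → Pointwise.decidable _≤?_ y c ×-dec d c y ≤ⁿ? R) C)

∣Q_∣ : ℕ → ℕ
∣Q zero ∣  = 1
∣Q suc n ∣ = ∣Q n ∣ + ∣Q n ∣

whole : ∀ n → Vec (Q n) ∣Q n ∣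
whole zero    = [] ∷ []
whole (suc n) = map (false ∷_) (whole n) ++ map (true ∷_) (whole n)

whole-unique : ∀ n → Unique (whole n)
whole-unique zero    = [] ∷ []
whole-unique (suc n) = AllPairs.++⁺
  (Unique.map⁺ ∷-injectiveʳ (whole-unique n))
  (Unique.map⁺ ∷-injectiveʳ (whole-unique n))
  (All.map⁺ (All.universal (λ _ → All.map⁺ (All.universal (λ _ ()) (whole n))) (whole n)))

∈-whole : ∀ {n} (y : Q n) → y ∈ᵛ whole n
∈-whole []          = here refl
∈-whole (false ∷ y) = ∈-++⁺ˡ (∈-map⁺ (false ∷_) (∈-whole y))
∈-whole {suc n} (true ∷ y) =
  ∈-++⁺ʳ (map (false ∷_) (whole n)) (∈-map⁺ (true ∷_) (∈-whole y))

d-self : ∀ {n} (y : Q n) → d y y ≡ 0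
d-self []          = refl
d-self (false ∷ y) = d-self y
d-self (true ∷ y)  = d-self y

self∈B⁻ : ∀ {n} R (y : Q n) → y ∈ B⁻ y R
self∈B⁻ R y = Pointwise.refl (_≤_.b≤b) , subst (_≤ⁿ R) (sym (d-self y)) z≤n

whole-isCode : ∀ n R → IsCode n R (whole n)
whole-isCode n R =
  whole-unique n , λ y → Any.map (λ { refl → self∈B⁻ R y }) (∈-whole y)

CodeOfSize : (n R : ℕ) → Pred ℕ 0ℓ
CodeOfSize n R k = ∃ λ (C : Vec (Q n) k) → IsCode n R C

K⁺-minimum : ∀ n R → ∃ (IsMinimum (CodeOfSize n R))
K⁺-minimum n R = minimum
  (λ k → search-Vec (search-Q n) k (isCode? n R))
  ∣Q n ∣ (whole n , whole-isCode n R)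

K⁺ : ℕ → ℕ → ℕ
K⁺ n R = proj₁ (K⁺-minimum n R)

MinimalCode : ℕ → ℕ → Set
MinimalCode n R = CodeOfSize n R (K⁺ n R)

someMinimalCode : ∀ n R → MinimalCode n R
someMinimalCode n R = proj₁ (proj₂ (K⁺-minimum n R))

TotalZeros TotalOnes : (n R : ℕ) → Pred ℕ 0ℓ
TotalZeros n R z = ∃ λ ((C , _) : MinimalCode n R) → totalZeros C ≡ z
TotalOnes  n R z = ∃ λ ((C , _) : MinimalCode n R) → totalOnes C ≡ z

searchMinimalCode : ∀ n R → Searchable (Vec (Q n) (K⁺ n R))
searchMinimalCode n R = search-Vec (search-Q n) (K⁺ n R)

hasTotal? : ∀ n R (f : Vec (Q n) (K⁺ n R) → ℕ) →
            Decidable (λ z → ∃ λ ((C , _) : MinimalCode n R) → f C ≡ z)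
hasTotal? n R f z = map′
  (λ { (C , c , e) → (C , c) , e })
  (λ { ((C , c) , e) → C , c , e })
  (searchMinimalCode n R λ C → isCode? n R C ×-dec f C ≟ⁿ z)

totalZeros-bound : ∀ {n k} (C : Vec (Q n) k) → totalZeros C ≤ⁿ k * n
totalZeros-bound []      = ≤-refl
totalZeros-bound (c ∷ C) = +-mono-≤ (count≤n (_≟ false) c) (totalZeros-bound C)

φ-maximum : ∀ n R → ∃ (IsMaximum (TotalZeros n R))
φ-maximum n R = maximum (hasTotal? n R totalZeros) (K⁺ n R * n)
  (λ { _ ((C , _) , refl) → totalZeros-bound C })
  (_ , someMinimalCode n R , refl)

φ̄-minimum : ∀ n R → ∃ (IsMinimum (TotalOnes n R))
φ̄-minimum n R = minimum (hasTotal? n R totalOnes)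
  _ (someMinimalCode n R , refl)

φ φ̄ : ℕ → ℕ → ℕ
φ n R = proj₁ (φ-maximum n R)
φ̄ n R = proj₁ (φ̄-minimum n R)

{-# OPTIONS --safe #-}
-- Puncturing coordinate i of the codewords c with cᵢ = 1 turns a code C for
-- Q (suc n) into a code for Q n: a codeword above y with a 1 inserted at i has
-- a 1 at i. Hence K⁺ n R is at most the number of codewords with a 1 at i, and
-- summing over i gives (1) and (2). The codeword covering 0 has a 0 somewhere
-- when R ≤ n, which makes the bound at that coordinate strict and gives (3).
-- Prefixing codewords with 1 absorbs one extra coordinate at the cost of one
-- unit of radius, so K⁺ (suc n) (suc R) ≤ K⁺ n R, and (4) follows from (3).
module Submission where

open import Defs
open import Data.Nat using (ℕ; suc; _∸_; NonZero; _≤_; _<_; _>_)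
open import Data.Integer using (+_)
open import Data.Rational using (_/_; _-_) renaming (_≤_ to _≤ℚ_; _≥_ to _≥ℚ_)
open import Data.Product using (_×_)

open import Data.Bool using (true; false; b≤b; f≤t)
open import Data.Bool.Properties using (_≟_)
open import Data.Fin using (Fin; zero; suc)
import Data.Integer as ℤ
import Data.Integer.Properties as ℤ
open import Data.Nat using (zero; _+_; _*_; z≤n; s≤s; s≤s⁻¹)
open import Data.Nat.Properties hiding (_≟_)
open import Data.Product using (∃; _,_; proj₁; proj₂)
open import Data.Rational as ℚ using (toℚᵘ; fromℚᵘ)
import Data.Rational.Properties as ℚ
open import Data.Rational.Unnormalised as ℚᵘ using (mkℚᵘ; *≤*; *≡*)
import Data.Rational.Unnormalised.Properties as ℚᵘ
open import Data.Vec using (Vec; []; _∷_; map; lookup; insertAt; removeAt; replicate)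
open import Data.Vec.Properties using (count≤n; insertAt-removeAt; ∷-injectiveʳ)
open import Data.Vec.Relation.Binary.Pointwise.Inductive using ([]; _∷_)
open import Data.Vec.Relation.Unary.All as All using (All; []; _∷_)
open import Data.Vec.Relation.Unary.AllPairs using ([]; _∷_)
open import Data.Vec.Relation.Unary.Any as Any using (Any; here; there)
import Data.Vec.Relation.Unary.Any.Properties as Any
open import Data.Vec.Relation.Unary.Unique.Propositional using (Unique)
import Data.Vec.Relation.Unary.Unique.Propositional.Properties as Unique
open import Algebra.Properties.CommutativeMonoid.Sum +-0-commutativeMonoid
  using (sum-syntax; ∑-distrib-+; sum-cong-≗; sum-replicate-zero)
open import Algebra.Properties.CommutativeSemigroup +-commutativeSemigroup using (interchange)
open import Algebra.Properties.Group ℚ.+-0-group using (//-rightDividesʳ)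
open import Function using (_∘_)
open import Level using (0ℓ)
import Relation.Binary.Reasoning.Setoid as ≈-Reasoning
open import Relation.Binary.PropositionalEquality
  using (_≡_; refl; sym; trans; cong; cong₂; subst; subst₂; module ≡-Reasoning)
open import Relation.Nullary using (does)
open import Relation.Unary using (Pred; _∈_)

private
  variable
    n k R : ℕ

K⁺-least : CodeOfSize n R k → K⁺ n R ≤ k
K⁺-least {n} {R} {k} = proj₂ (proj₂ (K⁺-minimum n R)) k

-- Puncturing a code at one coordinate.

onesAt : Fin n → Vec (Q n) k → ℕ
onesAt i C = ones (map (λ c → lookup c i) C)

-- Column `i` has one 1 for each codeword that is kept. The case split on `lookup c i` makes the
-- list and its length index compute together.
puncture : (i : Fin (suc n)) (C : Vec (Q (suc n)) k) → Vec (Q n) (onesAt i C)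
puncture i []      = []
puncture i (c ∷ C) with lookup c i
... | true  = removeAt c i ∷ puncture i C
... | false = puncture i C

module _ {P : Pred (Q n) 0ℓ} (i : Fin (suc n)) where

  Any-puncture : {C : Vec (Q (suc n)) k} →
    Any (λ c → lookup c i ≡ true × P (removeAt c i)) C → Any P (puncture i C)
  Any-puncture {C = c ∷ C} (here (_ , p)) with true ← lookup c i = here p
  Any-puncture {C = c ∷ C} (there p) with lookup c i
  ... | true  = there (Any-puncture p)
  ... | false = Any-puncture p

  All-puncture : {C : Vec (Q (suc n)) k} →
    All (λ c → lookup c i ≡ true → P (removeAt c i)) C → All P (puncture i C)
  All-puncture []                 = []
  All-puncture {C = c ∷ C} (p ∷ ps) with lookup c i
  ... | true  = p refl ∷ All-puncture ps
  ... | false = All-puncture ps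

removeAt-injective : ∀ (i : Fin (suc n)) {c c′ : Q (suc n)} →
  lookup c i ≡ lookup c′ i → removeAt c i ≡ removeAt c′ i → c ≡ c′
removeAt-injective i {c} {c′} e e′ = begin
  c                                        ≡⟨ insertAt-removeAt c i ⟨
  insertAt (removeAt c i) i (lookup c i)   ≡⟨ cong₂ (λ x b → insertAt x i b) e′ e ⟩
  insertAt (removeAt c′ i) i (lookup c′ i) ≡⟨ insertAt-removeAt c′ i ⟩
  c′                                       ∎
  where open ≡-Reasoning

-- All kept codewords agree at `i`, where they have a 1, so deleting that coordinate cannot identify
-- two of them.
puncture-unique : ∀ (i : Fin (suc n)) {C : Vec (Q (suc n)) k} →
  Unique C → Unique (puncture i C)
puncture-unique i []                = []
puncture-unique i {c ∷ C} (c∉C ∷ u) with lookup c i in eq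
... | false = puncture-unique i u
... | true  =
  All-puncture i (All.map (λ c≢c′ eq′ → c≢c′ ∘ removeAt-injective i (trans eq (sym eq′))) c∉C)
  ∷ puncture-unique i u

-- Only 1 lies above 1 in `Bool`, so the inserted 1 forces a 1 in `c`.
⪯-insertAt⁻ : ∀ (i : Fin (suc n)) {y : Q n} {c : Q (suc n)} →
  insertAt y i true ⪯ c → lookup c i ≡ true × y ⪯ removeAt c i
⪯-insertAt⁻ zero                      (b≤b ∷ y⪯c) = refl , y⪯c
-- Two entries of `c` must be visible before `removeAt c (suc i)` reduces.
⪯-insertAt⁻ (suc i) {_ ∷ _} {_ ∷ _ ∷ _} (b≤c ∷ y⪯c)
  with e , y⪯c′ ← ⪯-insertAt⁻ i y⪯c = e , b≤c ∷ y⪯c′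

-- Dropping a coordinate from both words can only lose a disagreement.
d-removeAt : ∀ (i : Fin (suc n)) (c : Q (suc n)) (y : Q n) b →
  d (removeAt c i) y ≤ d c (insertAt y i b)
d-removeAt zero    (a ∷ c)         y       b with does (a ≟ b)
... | true  = ≤-refl
... | false = n≤1+n _
d-removeAt (suc i) (a ∷ c@(_ ∷ _)) (x ∷ y) b with does (a ≟ x)
... | true  = d-removeAt i c y b
... | false = s≤s (d-removeAt i c y b)

puncture-covers : ∀ (i : Fin (suc n)) {C : Vec (Q (suc n)) k} →
  DownwardCovers R C → DownwardCovers R (puncture i C)
puncture-covers i covers y =
  Any-puncture i (Any.map punctured (covers (insertAt y i true)))
  where
  punctured : ∀ {c} → insertAt y i true ∈ B⁻ c R → lookup c i ≡ true × y ∈ B⁻ (removeAt c i) R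
  punctured {c = c} (y⪯c , d≤R) with e , y⪯c′ ← ⪯-insertAt⁻ i y⪯c =
    e , y⪯c′ , ≤-trans (d-removeAt i c y true) d≤R

K⁺-≤-onesAt : {C : Vec (Q (suc n)) k} → IsCode (suc n) R C → ∀ i → K⁺ n R ≤ onesAt i C
K⁺-≤-onesAt {C = C} (unique , covers) i =
  K⁺-least (puncture i C , puncture-unique i unique , puncture-covers i covers)

-- Counting ones and zeros over all coordinates.

ones-∷ : ∀ b (c : Q n) → ones (b ∷ c) ≡ ones (b ∷ []) + ones c
ones-∷ false c = refl
ones-∷ true  c = refl

∑-ones : ∀ (c : Q n) → ∑[ i < n ] ones (lookup c i ∷ []) ≡ ones c
∑-ones []      = refl
∑-ones (b ∷ c) = trans (cong (_+_ (ones (b ∷ []))) (∑-ones c)) (sym (ones-∷ b c))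

-- Double counting: the ones of the code matrix are summed by columns and by rows.
∑-onesAt : ∀ (C : Vec (Q n) k) → ∑[ i < n ] onesAt i C ≡ totalOnes C
∑-onesAt {n} []      = sum-replicate-zero n
∑-onesAt {n} (c ∷ C) = begin
  ∑[ i < n ] onesAt i (c ∷ C)
    ≡⟨ sum-cong-≗ (λ i → ones-∷ (lookup c i) (map (λ c → lookup c i) C)) ⟩
  ∑[ i < n ] (ones (lookup c i ∷ []) + onesAt i C)
    ≡⟨ ∑-distrib-+ (λ i → ones (lookup c i ∷ [])) (λ i → onesAt i C) ⟩
  ∑[ i < n ] ones (lookup c i ∷ []) + ∑[ i < n ] onesAt i C
    ≡⟨ cong₂ _+_ (∑-ones c) (∑-onesAt C) ⟩
  ones c + totalOnes C
    ∎
  where open ≡-Reasoning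

*-≤-∑ : ∀ n {m} {f : Fin n → ℕ} → (∀ i → m ≤ f i) → n * m ≤ ∑[ i < n ] f i
*-≤-∑ zero    m≤f = z≤n
*-≤-∑ (suc n) m≤f = +-mono-≤ (m≤f zero) (*-≤-∑ n (m≤f ∘ suc))

K⁺-≤-totalOnes : {C : Vec (Q (suc n)) k} → IsCode (suc n) R C → K⁺ n R * suc n ≤ totalOnes C
K⁺-≤-totalOnes {n} {R = R} {C} code = begin
  K⁺ n R * suc n              ≡⟨ *-comm (K⁺ n R) (suc n) ⟩
  suc n * K⁺ n R              ≤⟨ *-≤-∑ (suc n) (K⁺-≤-onesAt code) ⟩
  ∑[ i < suc n ] onesAt i C   ≡⟨ ∑-onesAt C ⟩
  totalOnes C                 ∎
  where open ≤-Reasoning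

zeros+ones : ∀ (c : Q n) → zeros c + ones c ≡ n
zeros+ones []          = refl
zeros+ones (false ∷ c) = cong suc (zeros+ones c)
zeros+ones (true ∷ c)  = trans (+-suc (zeros c) (ones c)) (cong suc (zeros+ones c))

totalZeros+totalOnes : ∀ (C : Vec (Q n) k) → totalZeros C + totalOnes C ≡ k * n
totalZeros+totalOnes []      = refl
totalZeros+totalOnes (c ∷ C) =
  trans (interchange (zeros c) (totalZeros C) (ones c) (totalOnes C))
        (cong₂ _+_ (zeros+ones c) (totalZeros+totalOnes C))

-- This is (1) with denominators cleared. A minimal code has `K⁺ (suc n) R * suc n` entries in all,
-- and its ones are bounded below by the column count. The total is a variable `z` so that its
-- equation can be matched with `refl`.
totalZeros+K⁺-≤ : ∀ {z} → TotalZeros (suc n) R z →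
  z + K⁺ n R * suc n ≤ K⁺ (suc n) R * suc n
totalZeros+K⁺-≤ {n} {R} ((C , code) , refl) = begin
  totalZeros C + K⁺ n R * suc n ≤⟨ +-monoʳ-≤ (totalZeros C) (K⁺-≤-totalOnes code) ⟩
  totalZeros C + totalOnes C    ≡⟨ totalZeros+totalOnes C ⟩
  K⁺ (suc n) R * suc n          ∎
  where open ≤-Reasoning

φ+K⁺-≤ : ∀ n R → φ (suc n) R + K⁺ n R * suc n ≤ K⁺ (suc n) R * suc n
φ+K⁺-≤ n R = totalZeros+K⁺-≤ (proj₁ (proj₂ (φ-maximum (suc n) R)))

K⁺-≤-φ̄ : ∀ n R → K⁺ n R * suc n ≤ φ̄ (suc n) R
K⁺-≤-φ̄ n R = bound (proj₁ (proj₂ (φ̄-minimum (suc n) R)))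
  where
  bound : ∀ {z} → TotalOnes (suc n) R z → K⁺ n R * suc n ≤ z
  bound ((C , code) , refl) = K⁺-≤-totalOnes code

-- Strict growth in the dimension.

-- The distance to the zero word is the number of ones, so a distance below `n` leaves room for a 0.
zero-coordinate : ∀ (c : Q n) → d c (replicate n false) < n → ∃ λ i → lookup c i ≡ false
zero-coordinate (false ∷ c) _   = zero , refl
zero-coordinate (true ∷ c)  d<n with i , e ← zero-coordinate c (s≤s⁻¹ d<n) = suc i , e

onesAt-< : {C : Vec (Q n) k} →
  Any (λ c → ∃ λ i → lookup c i ≡ false) C → ∃ λ i → onesAt i C < k
onesAt-< {C = c ∷ C} (here (i , e)) = i ,
  -- A leading 0 adds nothing to the column count, while the codeword still adds 1 to `k`.
  subst (λ b → ones (b ∷ map (λ c → lookup c i) C) < _) (sym e)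
        (s≤s (count≤n (_≟ true) (map (λ c → lookup c i) C)))
onesAt-< {C = c ∷ C} (there p) with i , lt ← onesAt-< p = i ,
  (begin-strict
    ones (lookup c i ∷ map (λ c → lookup c i) C) ≡⟨ ones-∷ (lookup c i) (map (λ c → lookup c i) C) ⟩
    ones (lookup c i ∷ []) + onesAt i C          ≤⟨ +-monoˡ-≤ _ (count≤n (_≟ true) (lookup c i ∷ [])) ⟩
    suc (onesAt i C)                             <⟨ s≤s lt ⟩
    _                                            ∎)
  where open ≤-Reasoning

K⁺-<-size : R ≤ n → CodeOfSize (suc n) R k → K⁺ n R < k
K⁺-<-size {R} {n} R≤n (C , code@(_ , covers))
  with i , lt ← onesAt-< (Any.map
    -- The codeword covering the zero word is within `R ≤ n < suc n` of it, so it is not all ones.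
    (λ { {c} (_ , d≤R) → zero-coordinate c (s≤s (≤-trans d≤R R≤n)) })
    (covers (replicate (suc n) false)))
  = ≤-<-trans (K⁺-≤-onesAt code i) lt

K⁺-monoˡ-< : R ≤ n → K⁺ n R < K⁺ (suc n) R
K⁺-monoˡ-< {R} {n} R≤n = K⁺-<-size R≤n (someMinimalCode (suc n) R)

-- Trading one coordinate for one unit of radius.

extend : CodeOfSize n R k → CodeOfSize (suc n) (suc R) k
extend {R = R} (C , unique , covers) =
  map (true ∷_) C
  , Unique.map⁺ ∷-injectiveʳ unique
  , λ { (b ∷ y) → Any.map⁺ (Any.map (∷-∈B⁻ b) (covers y)) }
  where
  ∷-∈B⁻ : ∀ b {y c} → y ∈ B⁻ c R → (b ∷ y) ∈ B⁻ (true ∷ c) (suc R)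
  -- A new digit 0 disagrees with the prefixed 1 and uses up the extra unit of radius; a new digit 1
  -- leaves it as slack.
  ∷-∈B⁻ false (y⪯c , d≤R) = f≤t ∷ y⪯c , s≤s d≤R
  ∷-∈B⁻ true  (y⪯c , d≤R) = b≤b ∷ y⪯c , m≤n⇒m≤1+n d≤R

K⁺-suc-suc : ∀ n R → K⁺ (suc n) (suc R) ≤ K⁺ n R
K⁺-suc-suc n R = K⁺-least (extend (someMinimalCode n R))

-- From inequalities in the naturals to fractions.

fromℚᵘ-mono-≤ : ∀ {p q} → p ℚᵘ.≤ q → fromℚᵘ p ≤ℚ fromℚᵘ q
fromℚᵘ-mono-≤ {p} {q} p≤q = ℚ.toℚᵘ-cancel-≤ (begin
  toℚᵘ (fromℚᵘ p) ≃⟨ ℚ.toℚᵘ-fromℚᵘ p ⟩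
  p               ≤⟨ p≤q ⟩
  q               ≃⟨ ℚ.toℚᵘ-fromℚᵘ q ⟨
  toℚᵘ (fromℚᵘ q) ∎)
  where open ℚᵘ.≤-Reasoning

fromℚᵘ-homo-+ : ∀ p q → fromℚᵘ (p ℚᵘ.+ q) ≡ fromℚᵘ p ℚ.+ fromℚᵘ q
fromℚᵘ-homo-+ p q = ℚ.toℚᵘ-injective (begin
  toℚᵘ (fromℚᵘ (p ℚᵘ.+ q))                 ≈⟨ ℚ.toℚᵘ-fromℚᵘ (p ℚᵘ.+ q) ⟩
  p ℚᵘ.+ q                                 ≈⟨ ℚᵘ.+-cong (ℚ.toℚᵘ-fromℚᵘ p) (ℚ.toℚᵘ-fromℚᵘ q) ⟨
  toℚᵘ (fromℚᵘ p) ℚᵘ.+ toℚᵘ (fromℚᵘ q)     ≈⟨ ℚ.toℚᵘ-homo-+ (fromℚᵘ p) (fromℚᵘ q) ⟨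
  toℚᵘ (fromℚᵘ p ℚ.+ fromℚᵘ q)             ∎)
  where open ≈-Reasoning ℚᵘ.≃-setoid

-- Once the denominators are successors, `_/_` is `fromℚᵘ` of an unnormalised fraction, whose order
-- is cross multiplication.
/-mono-≤ : ∀ a b m n .{{_ : NonZero m}} .{{_ : NonZero n}} →
  a * n ≤ b * m → (+ a) / m ≤ℚ (+ b) / n
/-mono-≤ a b m@(suc m-1) n@(suc n-1) le =
  fromℚᵘ-mono-≤ {mkℚᵘ (+ a) m-1} {mkℚᵘ (+ b) n-1}
    (*≤* (subst₂ ℤ._≤_ (ℤ.pos-* a n) (ℤ.pos-* b m) (ℤ.+≤+ le)))

/-+-/1 : ∀ a b n .{{_ : NonZero n}} → (+ (a + b * n)) / n ≡ (+ a) / n ℚ.+ (+ b) / 1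
/-+-/1 a b n@(suc n-1) = trans
  (ℚ.fromℚᵘ-cong {mkℚᵘ (+ (a + b * n)) n-1} {p ℚᵘ.+ q}
    -- The unnormalised sum has denominator `n * 1`, hence the identity law.
    (*≡* (cong₂ (λ m d → m ℤ.* + d) numerator (*-identityʳ n))))
  (fromℚᵘ-homo-+ p q)
  where
  p = mkℚᵘ (+ a) n-1
  q = mkℚᵘ (+ b) 0
  numerator : + (a + b * n) ≡ + a ℤ.* + 1 ℤ.+ + b ℤ.* + n
  numerator = cong₂ ℤ._+_ (sym (ℤ.*-identityʳ (+ a))) (ℤ.pos-* b n)

/1-≤-/ : ∀ a b n .{{_ : NonZero n}} → a * n ≤ b → (+ a) / 1 ≤ℚ (+ b) / n
/1-≤-/ a b n le = /-mono-≤ a b 1 n (subst (a * n ≤_) (sym (*-identityʳ b)) le)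

-- Adding and subtracting `b` puts the left side over the single denominator `n`, where the
-- hypothesis applies.
/-≤-difference : ∀ a b c n .{{_ : NonZero n}} →
  a + b * n ≤ c * n → (+ a) / n ≤ℚ (+ c) / 1 - (+ b) / 1
/-≤-difference a b c n le = begin
  (+ a) / n                              ≡⟨ //-rightDividesʳ ((+ b) / 1) ((+ a) / n) ⟨
  (+ a) / n ℚ.+ (+ b) / 1 - (+ b) / 1    ≡⟨ cong (_- (+ b) / 1) (/-+-/1 a b n) ⟨
  (+ (a + b * n)) / n - (+ b) / 1        ≤⟨ ℚ.+-monoˡ-≤ (ℚ.- ((+ b) / 1))
                                              (/-mono-≤ (a + b * n) c n 1
                                                (subst (_≤ c * n) (sym (*-identityʳ (a + b * n))) le)) ⟩
  (+ c) / 1 - (+ b) / 1                  ∎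
  where
  open ℚ.≤-Reasoning

-- Part (4) is guarded by `R < n`, since at `R = n` both sides equal 1.
proposition16 : ∀ (n R : ℕ) .{{_ : NonZero n}} → R ≤ n →
    ((+ K⁺ n R) / 1 - (+ K⁺ (n ∸ 1) R) / 1 ≥ℚ (+ φ n R) / n)
    × ((+ K⁺ (n ∸ 1) R) / 1 ≤ℚ (+ φ̄ n R) / n)
    × (K⁺ n R < K⁺ (suc n) R)
    × (R < n → K⁺ n R > K⁺ n (suc R))
proposition16 (suc n) R R≤n =
  /-≤-difference (φ (suc n) R) (K⁺ n R) (K⁺ (suc n) R) (suc n) (φ+K⁺-≤ n R) ,
  /1-≤-/ (K⁺ n R) (φ̄ (suc n) R) (suc n) (K⁺-≤-φ̄ n R) ,
  K⁺-monoˡ-< R≤n ,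
  -- Here the dimension is `suc n`, so `R < suc n` supplies the bound `R ≤ n` needed for strict
  -- growth from `n` to `suc n`.
  λ R<n → ≤-<-trans (K⁺-suc-suc n R) (K⁺-monoˡ-< (s≤s⁻¹ R<n))
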